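{- Let $K=(\mathcal T,\mathcal A)$ be an $\mathcal{ALC}^\Omega$ knowledge base and let $K^T=(\mathcal T^T,\mathcal A^T)$ be its translation into $\mathcal{ALCOI}$. The translation is complete, that is, for any query $F$ (over the language of $K$), with translation $F^T$: $$K\models_{\mathcal{ALC}^\Omega}F\ \Longrightarrow\ K^T\models_{\mathcal{ALCOI}}F^T .$$
   Context: **The theory $\Omega$.** First-order theory with binary relation symbols $\in,\subseteq$, binary function symbols $\cup,\backslash$ and a unary function symbol $\mathit{Pow}$, with axioms (universally closed): (1) $x\in y\cup z\leftrightarrow x\in y\vee x\in z$; (2) $x\in y\backslash z\leftrightarrow x\in y\wedge x\notin z$; (3) $x\subseteq y\leftrightarrow\forall z(z\in x\to z\in y)$; (4) $x\in \mathit{Pow}(y)\leftrightarrow x\subseteq y$. No extensionality or well-foundedness is assumed. An $\Omega$-model is a first-order structure with universe $\mathcal U$ satisfying these axioms; it is a model over a set of atoms $\mathbb A=\{\mathbf a_1,\mathbf a_2,\dots\}$ if $\mathbb A\subseteq\mathcal U$, where atoms are pairwise distinct elements having no members (distinct copies of the empty set). An element $x$ is a transitive set if $(\forall y\in x)(y\subseteq x)$. **$\mathcal{ALC}^\Omega$.** Let $N_C,N_R,N_I$ be disjoint sets of concept, role and individual names. Concepts: $A\in N_C$, $\top$, $\bot$, and, for concepts $C,D$ and $R\in N_R$: $C\sqcap D$, $C\sqcup D$, $\neg C$, $C\backslash D$, $\mathtt{Pow}(C)$, $\forall R.C$, $\exists R.C$. A knowledge base (KB) is $K=(\mathcal T,\mathcal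 A)$, with $\mathcal T$ (TBox) a (finite) set of inclusions $C\sqsubseteq D$, and $\mathcal A$ (ABox) a (finite) set of assertions $C(a)$, $R(a,b)$ ($a,b\in N_I$), concept membership axioms $C\in D$ and role membership axioms $(C,D)\in R$. An interpretation over atoms $\mathbb A$ is $I=\langle\Delta,\cdot^I\rangle$ where $\Delta$ is a non-empty transitive set in the universe $\mathcal U$ of an $\Omega$-model over $\mathbb A$; $A^I\subseteq\Delta$ for $A\in N_C$; $R^I\subseteq\Delta\times\Delta$ for $R\in N_R$; $a^I\in\mathbb A\cap\Delta$ for $a\in N_I$. Extension to complex concepts: $\top^I=\Delta$, $\bot^I=\emptyset$, $(\neg C)^I=\Delta\backslash C^I$, $(C\sqcap D)^I=C^I\cap D^I$, $(C\sqcup D)^I=C^I\cup D^I$, $(C\backslash D)^I=C^I\backslash D^I$, $(\mathtt{Pow}(C))^I=\mathit{Pow}(C^I)\cap\Delta$, $(\forall R.C)^I=\{x\in\Delta\mid\forall y((x,y)\in R^I\to y\in C^I)\}$, $(\exists R.C)^I=\{x\in\Delta\mid\exists y((x,y)\in R^I\wedge y\in C^I)\}$. $I$ satisfies $C\sqsubseteq D$ iff $C^I\subseteq D^I$; $C(a)$ iff $a^I\in C^I$; $R(a,b)$ iff $(a^I,b^I)\in R^I$; $C\in D$ iff $C^I\in D^I$; $(C,D)\in R$ iff $(C^I,D^I)\in R^I$. $I$ is a model of $K$ if it satisfies all elements of $\mathcal T$ and $\mathcal A$. $K\models_{\mathcal{ALC}^\Omega}F$ means every model of $K$ satisfies $F$.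 **$\mathcal{ALCOI}$.** The standard description logic $\mathcal{ALC}$ (usual set-theoretic semantics over arbitrary non-empty domains) extended with inverse roles $R^-$ (where $(x,y)\in(R^-)^I$ iff $(y,x)\in R^I$) and nominals $\{a\}$ (where $(\{a\})^I=\{a^I\}$). $C\equiv D$ abbreviates $C\sqsubseteq D$ and $D\sqsubseteq C$. Entailment $\models_{\mathcal{ALCOI}}$ is truth in all models. **Translation.** Let $e$ be a new role name. For an $\mathcal{ALC}^\Omega$ concept $C$, $C^T$ is obtained by recursively replacing each subconcept $\mathtt{Pow}(D)$ by $\forall e.D^T$; $T$ commutes with all other constructors (with $C\backslash D$ read as $C\sqcap\neg D$), and $B^T=B$ for concept names $B$. For each concept $C$ occurring as an instance in a membership axiom of $K$ or of the query (i.e. $C$ in $C\in D$; $C$ and $D$ in $(C,D)\in R$) introduce a new individual name $e_C$. $\mathcal T^T$ consists of $C^T\sqsubseteq D^T$ for each $C\sqsubseteq D\in\mathcal T$, and $C^T\equiv\exists e^-.\{e_C\}$ for each such new name $e_C$. $\mathcal A^T$ consists of: $D^T(e_C)$ for each $C\in D$ in $\mathcal A$; $R(e_C,e_D)$ for each $(C,D)\in R$ in $\mathcal A$; $D^T(a)$ for each $D(a)$ in $\mathcal A$; $R(a,b)$ for each $R(a,b)$ in $\mathcal A$; and $(\neg\exists e.\top)(a)$ for each (original) individual name $a\in N_I$. A query $F$ has the form $C\sqsubseteq D$, $C(a)$ or $C\in D$, where all individual, concept and role names occurring in $F$ occur in $K$. $F^T$ is, respectively, $C^T\sqsubseteq D^T$,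 $C^T(a)$, $D^T(e_C)$.
   Formalization: The clauses for complex concepts, such as (¬C)^I = Δ\C^I, are required only up to having the same members, each C^I being any element with those members; read as identities they refute the claim, e.g. for K = {¬A ∈ D, (⊤\A) ∈ ¬D}. -}

module Defs where

open import Data.Empty using () renaming (⊥ to 𝟘)
open import Data.List.Base using (List; []; _∷_; _++_; concatMap)
open import Data.List.Membership.Propositional using () renaming (_∈_ to _∈ˡ_)
open import Data.List.Relation.Binary.Subset.Propositional using () renaming (_⊆_ to _⊆ˡ_)
open import Data.List.Relation.Unary.All using (All)
open import Data.Product.Base using (_×_; ∃)
open import Data.Sum.Base using (_⊎_)
open import Data.Unit.Base using () renaming (⊤ to 𝟙)
open import Function.Bundles using (_⇔_)
open import Function.Definitions using (Injective)
open import Relation.Binary.PropositionalEquality.Core using (_≡_)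
open import Relation.Nullary.Negation.Core using (¬_)

record Signature : Set₁ where
  field
    ConceptName : Set
    RoleName    : Set
    IndName     : Set

------------------------------------------------------------------------
-- The theory Ω

record ΩModel : Set₁ where
  infix  4 _∈_ _⊆_ _∉_ _≐_
  infixl 6 _∪_ _∖_
  field
    𝒰   : Set
    _∈_ : 𝒰 → 𝒰 → Set
    _⊆_ : 𝒰 → 𝒰 → Set
    _∪_ : 𝒰 → 𝒰 → 𝒰
    _∖_ : 𝒰 → 𝒰 → 𝒰
    Pow : 𝒰 → 𝒰

  _∉_ : 𝒰 → 𝒰 → Set
  x ∉ y = ¬ (x ∈ y)

  field
    ∪-axiom   : ∀ x y z → x ∈ y ∪ z ⇔ (x ∈ y ⊎ x ∈ z)
    ∖-axiom   : ∀ x y z → x ∈ y ∖ z ⇔ (x ∈ y × x ∉ z)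
    ⊆-axiom   : ∀ x y → x ⊆ y ⇔ (∀ z → z ∈ x → z ∈ y)
    Pow-axiom : ∀ x y → x ∈ Pow y ⇔ x ⊆ y

  -- Having the same members; Ω does not prove that this implies equality.
  _≐_ : 𝒰 → 𝒰 → Set
  x ≐ y = ∀ z → z ∈ x ⇔ z ∈ y

  IsTransitive : 𝒰 → Set
  IsTransitive x = ∀ y → y ∈ x → y ⊆ x

-- The set of atoms is given as the image of an injection 𝔸 → 𝒰.
record ΩModelOver (𝔸 : Set) : Set₁ where
  field
    Ω : ΩModel

  open ΩModel Ω public

  field
    atom           : 𝔸 → 𝒰
    atom-injective : Injective _≡_ _≡_ atom
    atom-empty     : ∀ α x → x ∉ atom α

------------------------------------------------------------------------
-- The description logic ALC^Ω

module ALCΩ (S : Signature) where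
  open Signature S

  infix  8 ¬ᶜ_ ∀⟨_⟩_ ∃⟨_⟩_
  infixl 7 _⊓_
  infixl 6 _⊔_ _∖_
  infix  4 _⊑_ _∈_

  data Concept : Set where
    name        : ConceptName → Concept
    ⊤ ⊥         : Concept
    _⊓_ _⊔_ _∖_ : Concept → Concept → Concept
    ¬ᶜ_         : Concept → Concept
    Pow         : Concept → Concept
    ∀⟨_⟩_ ∃⟨_⟩_ : RoleName → Concept → Concept

  data Inclusion : Set where
    _⊑_ : Concept → Concept → Inclusion

  data Assertion : Set where
    instanceOf : Concept → IndName → Assertion              -- C(a)
    related    : RoleName → IndName → IndName → Assertion   -- R(a,b)
    _∈_        : Concept → Concept → Assertion              -- C ∈ D
    relatedᶜ   : RoleName → Concept → Concept → Assertion   -- (C,D) ∈ R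

  record KB : Set where
    constructor _,_
    field
      TBox : List Inclusion
      ABox : List Assertion

  data Query : Set where
    _⊑_        : Concept → Concept → Query
    instanceOf : Concept → IndName → Query
    _∈_        : Concept → Concept → Query

  -- Each C^I is an element of 𝒰.  Ω has neither extensionality nor a
  -- comprehension scheme, so the semantic clauses determine C^I only up to _≐_:
  -- which of the elements with the prescribed members is C^I is part of the
  -- interpretation.  Reading the clauses as identities in 𝒰 would identify
  -- (¬A)^I with (⊤∖A)^I, although a membership axiom may hold of one and not
  -- of the other in the translation, where they have different names.
  record Interpretation (𝔸 : Set) : Set₁ where
    field
      modelΩ : ΩModelOver 𝔸

    open ΩModelOver modelΩ public
      renaming (_∈_ to _∈ᵁ_; _∉_ to _∉ᵁ_; _⊆_ to _⊆ᵁ_; _∪_ to _∪ᵁ_; _∖_ to _∖ᵁ_; Pow to Powᵁ)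

    field
      Δ            : 𝒰
      Δ-nonempty   : ∃ λ x → x ∈ᵁ Δ
      Δ-transitive : IsTransitive Δ

      ⟦_⟧   : Concept → 𝒰
      roleᴵ : RoleName → 𝒰 → 𝒰 → Set
      indᴵ  : IndName → 𝔸

      name-⊆ : ∀ A → ⟦ name A ⟧ ⊆ᵁ Δ
      role-⊆ : ∀ R x y → roleᴵ R x y → x ∈ᵁ Δ × y ∈ᵁ Δ
      ind-∈  : ∀ a → atom (indᴵ a) ∈ᵁ Δ

      ⟦⊤⟧   : ⟦ ⊤ ⟧ ≐ Δ
      ⟦⊥⟧   : ∀ x → x ∉ᵁ ⟦ ⊥ ⟧
      ⟦¬⟧   : ∀ C → ⟦ ¬ᶜ C ⟧ ≐ Δ ∖ᵁ ⟦ C ⟧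
      ⟦⊓⟧   : ∀ C D x → x ∈ᵁ ⟦ C ⊓ D ⟧ ⇔ (x ∈ᵁ ⟦ C ⟧ × x ∈ᵁ ⟦ D ⟧)
      ⟦⊔⟧   : ∀ C D → ⟦ C ⊔ D ⟧ ≐ ⟦ C ⟧ ∪ᵁ ⟦ D ⟧
      ⟦∖⟧   : ∀ C D → ⟦ C ∖ D ⟧ ≐ ⟦ C ⟧ ∖ᵁ ⟦ D ⟧
      ⟦Pow⟧ : ∀ C x → x ∈ᵁ ⟦ Pow C ⟧ ⇔ (x ∈ᵁ Powᵁ ⟦ C ⟧ × x ∈ᵁ Δ)
      ⟦∀⟧   : ∀ R C x → x ∈ᵁ ⟦ ∀⟨ R ⟩ C ⟧ ⇔ (x ∈ᵁ Δ × (∀ y → roleᴵ R x y → y ∈ᵁ ⟦ C ⟧))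
      ⟦∃⟧   : ∀ R C x → x ∈ᵁ ⟦ ∃⟨ R ⟩ C ⟧ ⇔ (x ∈ᵁ Δ × ∃ λ y → roleᴵ R x y × y ∈ᵁ ⟦ C ⟧)

    indᵁ : IndName → 𝒰
    indᵁ a = atom (indᴵ a)

  module _ {𝔸 : Set} (I : Interpretation 𝔸) where
    open Interpretation I

    SatisfiesInclusion : Inclusion → Set
    SatisfiesInclusion (C ⊑ D) = ⟦ C ⟧ ⊆ᵁ ⟦ D ⟧

    SatisfiesAssertion : Assertion → Set
    SatisfiesAssertion (instanceOf C a) = indᵁ a ∈ᵁ ⟦ C ⟧
    SatisfiesAssertion (related R a b)  = roleᴵ R (indᵁ a) (indᵁ b)
    SatisfiesAssertion (C ∈ D)          = ⟦ C ⟧ ∈ᵁ ⟦ D ⟧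
    SatisfiesAssertion (relatedᶜ R C D) = roleᴵ R ⟦ C ⟧ ⟦ D ⟧

    SatisfiesQuery : Query → Set
    SatisfiesQuery (C ⊑ D)          = ⟦ C ⟧ ⊆ᵁ ⟦ D ⟧
    SatisfiesQuery (instanceOf C a) = indᵁ a ∈ᵁ ⟦ C ⟧
    SatisfiesQuery (C ∈ D)          = ⟦ C ⟧ ∈ᵁ ⟦ D ⟧

    IsModel : KB → Set
    IsModel (𝒯 , 𝒜) = All SatisfiesInclusion 𝒯 × All SatisfiesAssertion 𝒜

  infix 3 _⊨_
  _⊨_ : KB → Query → Set₁
  K ⊨ F = ∀ {𝔸 : Set} (I : Interpretation 𝔸) → IsModel I K → SatisfiesQuery I F

  data Symbol : Set where
    concept : ConceptName → Symbol
    role    : RoleName → Symbol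
    ind     : IndName → Symbol

  conceptSymbols : Concept → List Symbol
  conceptSymbols (name A)   = concept A ∷ []
  conceptSymbols ⊤          = []
  conceptSymbols ⊥          = []
  conceptSymbols (C ⊓ D)    = conceptSymbols C ++ conceptSymbols D
  conceptSymbols (C ⊔ D)    = conceptSymbols C ++ conceptSymbols D
  conceptSymbols (C ∖ D)    = conceptSymbols C ++ conceptSymbols D
  conceptSymbols (¬ᶜ C)     = conceptSymbols C
  conceptSymbols (Pow C)    = conceptSymbols C
  conceptSymbols (∀⟨ R ⟩ C) = role R ∷ conceptSymbols C
  conceptSymbols (∃⟨ R ⟩ C) = role R ∷ conceptSymbols C

  inclusionSymbols : Inclusion → List Symbol
  inclusionSymbols (C ⊑ D) = conceptSymbols C ++ conceptSymbols D

  assertionSymbols : Assertion → List Symbol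
  assertionSymbols (instanceOf C a) = ind a ∷ conceptSymbols C
  assertionSymbols (related R a b)  = role R ∷ ind a ∷ ind b ∷ []
  assertionSymbols (C ∈ D)          = conceptSymbols C ++ conceptSymbols D
  assertionSymbols (relatedᶜ R C D) = role R ∷ conceptSymbols C ++ conceptSymbols D

  querySymbols : Query → List Symbol
  querySymbols (C ⊑ D)          = conceptSymbols C ++ conceptSymbols D
  querySymbols (instanceOf C a) = ind a ∷ conceptSymbols C
  querySymbols (C ∈ D)          = conceptSymbols C ++ conceptSymbols D

  kbSymbols : KB → List Symbol
  kbSymbols (𝒯 , 𝒜) = concatMap inclusionSymbols 𝒯 ++ concatMap assertionSymbols 𝒜

  OverLanguageOf : KB → Query → Set
  OverLanguageOf K F = querySymbols F ⊆ˡ kbSymbols K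

------------------------------------------------------------------------
-- The description logic ALCOI

module ALCOI (S : Signature) where
  open Signature S

  infix  9 _⁻
  infix  8 ¬ᶜ_ ∀⟨_⟩_ ∃⟨_⟩_
  infixl 7 _⊓_
  infixl 6 _⊔_
  infix  4 _⊑_

  data Role : Set where
    role : RoleName → Role
    _⁻   : RoleName → Role

  data Concept : Set where
    name        : ConceptName → Concept
    ⊤ ⊥         : Concept
    _⊓_ _⊔_     : Concept → Concept → Concept
    ¬ᶜ_         : Concept → Concept
    ∀⟨_⟩_ ∃⟨_⟩_ : Role → Concept → Concept
    ｛_｝        : IndName → Concept

  data Inclusion : Set where
    _⊑_ : Concept → Concept → Inclusion

  data Assertion : Set where
    instanceOf : Concept → IndName → Assertion
    related    : RoleName → IndName → IndName → Assertion

  record KB : Set₁ where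
    constructor _,_
    field
      TBox : Inclusion → Set
      ABox : Assertion → Set

  data Query : Set where
    _⊑_        : Concept → Concept → Query
    instanceOf : Concept → IndName → Query

  record Interpretation : Set₁ where
    field
      Domain   : Set
      nonempty : Domain
      nameᴵ    : ConceptName → Domain → Set
      roleᴵ    : RoleName → Domain → Domain → Set
      indᴵ     : IndName → Domain

    ⟦_⟧ʳ : Role → Domain → Domain → Set
    ⟦ role r ⟧ʳ x y = roleᴵ r x y
    ⟦ r ⁻ ⟧ʳ    x y = roleᴵ r y x

    ⟦_⟧ : Concept → Domain → Set
    ⟦ name A ⟧   x = nameᴵ A x
    ⟦ ⊤ ⟧        x = 𝟙
    ⟦ ⊥ ⟧        x = 𝟘
    ⟦ C ⊓ D ⟧    x = ⟦ C ⟧ x × ⟦ D ⟧ x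
    ⟦ C ⊔ D ⟧    x = ⟦ C ⟧ x ⊎ ⟦ D ⟧ x
    ⟦ ¬ᶜ C ⟧     x = ¬ (⟦ C ⟧ x)
    ⟦ ∀⟨ R ⟩ C ⟧ x = ∀ y → ⟦ R ⟧ʳ x y → ⟦ C ⟧ y
    ⟦ ∃⟨ R ⟩ C ⟧ x = ∃ λ y → ⟦ R ⟧ʳ x y × ⟦ C ⟧ y
    ⟦ ｛ a ｝ ⟧   x = x ≡ indᴵ a

  module _ (I : Interpretation) where
    open Interpretation I

    SatisfiesInclusion : Inclusion → Set
    SatisfiesInclusion (C ⊑ D) = ∀ x → ⟦ C ⟧ x → ⟦ D ⟧ x

    SatisfiesAssertion : Assertion → Set
    SatisfiesAssertion (instanceOf C a) = ⟦ C ⟧ (indᴵ a)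
    SatisfiesAssertion (related R a b)  = roleᴵ R (indᴵ a) (indᴵ b)

    SatisfiesQuery : Query → Set
    SatisfiesQuery (C ⊑ D)          = ∀ x → ⟦ C ⟧ x → ⟦ D ⟧ x
    SatisfiesQuery (instanceOf C a) = ⟦ C ⟧ (indᴵ a)

    IsModel : KB → Set
    IsModel (𝒯 , 𝒜) = (∀ φ → 𝒯 φ → SatisfiesInclusion φ) × (∀ α → 𝒜 α → SatisfiesAssertion α)

  infix 3 _⊨_
  _⊨_ : KB → Query → Set₁
  K ⊨ F = ∀ (I : Interpretation) → IsModel I K → SatisfiesQuery I F

------------------------------------------------------------------------
-- The translation of K and F; the new individual names depend on both.

module Translation {S : Signature} (K : ALCΩ.KB S) (F : ALCΩ.Query S) where
  open Signature S
  open ALCΩ S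
  open KB K

  data OccursAsInstance (C : Concept) : Set where
    in-∈     : ∀ {D}   → (C ∈ D) ∈ˡ ABox → OccursAsInstance C
    in-role₁ : ∀ {R D} → relatedᶜ R C D ∈ˡ ABox → OccursAsInstance C
    in-role₂ : ∀ {R D} → relatedᶜ R D C ∈ˡ ABox → OccursAsInstance C
    in-query : ∀ {D}   → F ≡ (C ∈ D) → OccursAsInstance C

  data RoleNameᵀ : Set where
    old : RoleName → RoleNameᵀ
    e   : RoleNameᵀ

  -- The occurrence is irrelevant, so that each C has at most one name.
  data IndNameᵀ : Set where
    old  : IndName → IndNameᵀ
    e[_] : (C : Concept) → .(OccursAsInstance C) → IndNameᵀ

  Sᵀ : Signature
  Sᵀ = record { ConceptName = ConceptName ; RoleName = RoleNameᵀ ; IndName = IndNameᵀ }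

  module O = ALCOI Sᵀ
  open O using (role; _⁻; ｛_｝)

  infix 10 _ᵀ
  _ᵀ : Concept → O.Concept
  (name A) ᵀ   = O.name A
  ⊤ ᵀ          = O.⊤
  ⊥ ᵀ          = O.⊥
  (C ⊓ D) ᵀ    = C ᵀ O.⊓ D ᵀ
  (C ⊔ D) ᵀ    = C ᵀ O.⊔ D ᵀ
  (C ∖ D) ᵀ    = C ᵀ O.⊓ (O.¬ᶜ D ᵀ)
  (¬ᶜ C) ᵀ     = O.¬ᶜ C ᵀ
  (Pow C) ᵀ    = O.∀⟨ role e ⟩ C ᵀ
  (∀⟨ R ⟩ C) ᵀ = O.∀⟨ role (old R) ⟩ C ᵀ
  (∃⟨ R ⟩ C) ᵀ = O.∃⟨ role (old R) ⟩ C ᵀ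

  data TBoxᵀ : O.Inclusion → Set where
    inclusion : ∀ {C D} → (C ⊑ D) ∈ˡ TBox → TBoxᵀ (C ᵀ O.⊑ D ᵀ)
    naming-⊑  : ∀ {C} (o : OccursAsInstance C) → TBoxᵀ (C ᵀ O.⊑ O.∃⟨ e ⁻ ⟩ ｛ e[ C ] o ｝)
    naming-⊒  : ∀ {C} (o : OccursAsInstance C) → TBoxᵀ (O.∃⟨ e ⁻ ⟩ ｛ e[ C ] o ｝ O.⊑ C ᵀ)

  data ABoxᵀ : O.Assertion → Set where
    membership : ∀ {C D} (p : (C ∈ D) ∈ˡ ABox) →
                 ABoxᵀ (O.instanceOf (D ᵀ) (e[ C ] (in-∈ p)))
    roleᶜ      : ∀ {R C D} (p : relatedᶜ R C D ∈ˡ ABox) →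
                 ABoxᵀ (O.related (old R) (e[ C ] (in-role₁ p)) (e[ D ] (in-role₂ p)))
    concept    : ∀ {D a} → instanceOf D a ∈ˡ ABox → ABoxᵀ (O.instanceOf (D ᵀ) (old a))
    role       : ∀ {R a b} → related R a b ∈ˡ ABox → ABoxᵀ (O.related (old R) (old a) (old b))
    atomic     : ∀ a → ABoxᵀ (O.instanceOf (O.¬ᶜ O.∃⟨ role e ⟩ O.⊤) (old a))

  KBᵀ : O.KB
  KBᵀ = TBoxᵀ O., ABoxᵀ

  translateQuery : (G : Query) → F ≡ G → O.Query
  translateQuery (C ⊑ D)          _ = C ᵀ O.⊑ D ᵀ
  translateQuery (instanceOf C a) _ = O.instanceOf (C ᵀ) (old a)
  translateQuery (C ∈ D)          p = O.instanceOf (D ᵀ) (e[ C ] (in-query p))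

  Queryᵀ : O.Query
  Queryᵀ = translateQuery F _≡_.refl

{-# OPTIONS --safe #-}
-- Given a model I of Kᵀ, every d in its domain becomes a set el d whose members
-- are its e-successors, and every concept C a set con C with extension (Cᵀ)^I.
-- If C occurs as an instance, con C is treated as a copy of el e_C: by the
-- naming axioms the two have the same members, and Ω does not force them to be
-- equal.  No decision whether C occurs is needed.
--
-- These sets have to be embedded in an Ω-model.  The clause "x ∈ Pow t iff
-- x ⊆ t" is circular on terms, since x may be more complex than t.  With
-- V 0, V 1 = Pow (V 0), … the cumulative hierarchy over the base sets, one
-- defines instead, by recursion on n, the relation "x ∩ V (n - 1) belongs to t";
-- it is stationary once n exceeds the number of nested Pow in x.
module Submission where

open import Data.Empty using (⊥-elim; ⊥-elim-irr)
open import Data.List.Membership.Propositional using () renaming (_∈_ to _∈ˡ_)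
open import Data.List.Relation.Unary.All using (tabulate)
open import Data.Nat.Base using (ℕ; zero; suc; _≤_; _⊔_; _≤′_; ≤′-refl; ≤′-step; z≤n; s≤s)
open import Data.Nat.Properties
  using (≤-refl; m≤m⊔n; m≤n⊔m; m⊔n≤o⇒m≤o; m⊔n≤o⇒n≤o; ≤⇒≤′; ≤′⇒≤)
open import Data.Product.Base using (_×_; _,_; ∃; proj₁; proj₂)
open import Data.Product.Function.NonDependent.Propositional using (_×-⇔_)
open import Data.Sum.Base using (_⊎_; inj₁; inj₂)
open import Data.Sum.Function.Propositional using (_⊎-⇔_)
open import Data.Unit.Base using (tt)
open import Function.Base using (_∘_)
open import Function.Bundles using (_⇔_; mk⇔; Equivalence)
open import Function.Construct.Composition using (_⇔-∘_)
open import Function.Properties.Equivalence using () renaming (refl to ⇔-refl)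
open import Relation.Binary.PropositionalEquality.Core using (_≡_; refl; subst)
open import Relation.Nullary.Negation.Core using (¬_)

open import Defs

open Equivalence using (to; from)

-- Terms over a base relation and truncated membership

module Superstructure {B : Set} (_∈ᴮ_ : B → B → Set) where

  infixl 6 _∪_ _∩_ _∖_
  infix  4 _∈ᵇ_ _∈[_]_ _∈_

  -- `𝔹` collects the base sets. `_∩_` is a constructor so that the truncation of a composite term
  -- by some `V n` is again a term.
  data Term : Set where
    ι           : B → Term
    𝔹           : Term
    _∪_ _∩_ _∖_ : Term → Term → Term
    Pow         : Term → Term

  data Base : Term → Set where
    ι : ∀ b → Base (ι b)

  data _∈ᵇ_ : Term → Term → Set where
    ι : ∀ {a b} → a ∈ᴮ b → ι a ∈ᵇ ι b

  base? : ∀ x → Base x ⊎ ¬ Base x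
  base? (ι b)   = inj₁ (ι b)
  base? 𝔹       = inj₂ λ ()
  base? (_ ∪ _) = inj₂ λ ()
  base? (_ ∩ _) = inj₂ λ ()
  base? (_ ∖ _) = inj₂ λ ()
  base? (Pow _) = inj₂ λ ()

  ∈ᵇ⇒Baseʳ : ∀ {x y} → x ∈ᵇ y → Base y
  ∈ᵇ⇒Baseʳ (ι _) = ι _

  ∈ᵇ⇒Baseˡ : ∀ {x y} → x ∈ᵇ y → Base x
  ∈ᵇ⇒Baseˡ (ι _) = ι _

  -- x ∩ V (n - 1) belongs to t, where V (-1) is empty and a base set counts as
  -- its own intersection with V (n - 1).
  _∈[_]_ : Term → ℕ → Term → Set
  x ∈[ n ]     ι b   = x ∈ᵇ ι b
  x ∈[ n ]     𝔹     = Base x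
  x ∈[ n ]     s ∪ t = x ∈[ n ] s ⊎ x ∈[ n ] t
  x ∈[ n ]     s ∩ t = x ∈[ n ] s × x ∈[ n ] t
  x ∈[ n ]     s ∖ t = x ∈[ n ] s × ¬ (x ∈[ n ] t)
  x ∈[ zero ]  Pow t = ∀ z → z ∈ᵇ x → z ∈[ zero ] t
  x ∈[ suc n ] Pow t = ∀ z → z ∈[ n ] x → z ∈[ n ] t

  -- Agreement and stability across levels

  Agree : ℕ → Term → ℕ → Term → Set
  Agree m x n y = ∀ t → x ∈[ m ] t ⇔ y ∈[ n ] t

  Stable : ℕ → Term → Set
  Stable n x = Agree (suc n) x n x

  data Alike (x : Term) : Term → Set where
    same      : Alike x x
    composite : ∀ {y} → ¬ Base x → ¬ Base y → Alike x y

  ¬-cong : {P Q : Set} → P ⇔ Q → (¬ P) ⇔ (¬ Q)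
  ¬-cong p = mk⇔ (_∘ from p) (_∘ to p)

  -- Every `t` is built by Boolean operations from `ι b`, `𝔹` and terms `Pow s`; `Alike` settles the
  -- first two, since a non-base term lies in neither.
  agree-by-Pow : ∀ {m n x y} → Alike x y →
                 (∀ t → x ∈[ m ] Pow t ⇔ y ∈[ n ] Pow t) → Agree m x n y
  agree-by-Pow same            pow (ι b) = ⇔-refl
  agree-by-Pow (composite p q) pow (ι b) = mk⇔ (⊥-elim ∘ p ∘ ∈ᵇ⇒Baseˡ) (⊥-elim ∘ q ∘ ∈ᵇ⇒Baseˡ)
  agree-by-Pow same            pow 𝔹     = ⇔-refl
  agree-by-Pow (composite p q) pow 𝔹     = mk⇔ (⊥-elim ∘ p) (⊥-elim ∘ q)
  agree-by-Pow a pow (s ∪ t) = agree-by-Pow a pow s ⊎-⇔ agree-by-Pow a pow t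
  agree-by-Pow a pow (s ∩ t) = agree-by-Pow a pow s ×-⇔ agree-by-Pow a pow t
  agree-by-Pow a pow (s ∖ t) = agree-by-Pow a pow s ×-⇔ ¬-cong (agree-by-Pow a pow t)
  agree-by-Pow a pow (Pow t) = pow t

  base-stable : ∀ n {x} → Base x → Stable n x
  base-stable zero    (ι b) = agree-by-Pow same λ t → ⇔-refl
  base-stable (suc n) (ι b) = agree-by-Pow same λ t → mk⇔
    (λ h z z∈b → to   (base-stable n (∈ᵇ⇒Baseˡ z∈b) t) (h z z∈b))
    (λ h z z∈b → from (base-stable n (∈ᵇ⇒Baseˡ z∈b) t) (h z z∈b))

  -- Chosen so that members of `x` are stable from level `rank x` on. Members of an intersection or
  -- difference are members of its left side, so only that side counts.
  rank : Term → ℕ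
  rank (ι b)   = 0
  rank 𝔹       = 0
  rank (s ∪ t) = rank s ⊔ rank t
  rank (s ∩ t) = rank s
  rank (s ∖ t) = rank s
  rank (Pow t) = suc (rank t)

  ∅ : Term
  ∅ = 𝔹 ∖ 𝔹

  V : ℕ → Term
  V zero    = 𝔹 ∪ Pow ∅
  V (suc n) = Pow (V n)

  rank-V : ∀ n → rank (V n) ≤ suc n
  rank-V zero    = ≤-refl
  rank-V (suc n) = s≤s (rank-V n)

  -- Whatever `x` is, its part inside `V (n - 1)` is an element of the next stage.
  ∈[]-V : ∀ n x → x ∈[ n ] V n
  ∈[]-V zero x with base? x
  ... | inj₁ b  = inj₁ b
  ... | inj₂ ¬b = inj₂ λ z z∈x → ⊥-elim (¬b (∈ᵇ⇒Baseʳ z∈x))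
  ∈[]-V (suc n) x z _ = ∈[]-V n z

  -- `x′` is `x ∩ V (n - 1)` as a term; its rank bound makes level `suc n` its full membership.
  Truncation : ℕ → Term → Set
  Truncation n x = ∃ λ x′ → rank x′ ≤ n × Agree (suc n) x′ n x

  -- The two levels of `Pow t` quantify over `z` at adjacent levels. Going down, `z` is replaced by
  -- its truncation; going up, `z` is stable by hypothesis.
  stable-suc : ∀ {n} → (∀ x → Truncation n x) →
               ∀ {x} → (∀ z → z ∈[ suc n ] x → Stable n z) → Stable (suc n) x
  stable-suc trunc {x} st = agree-by-Pow same λ t → mk⇔
    (λ h z z∈x → let z′ , _ , z′~z = trunc z in to (z′~z t) (h z′ (from (z′~z x) z∈x)))
    (λ h z z∈x → from (st z z∈x t) (h z (to (st z z∈x x) z∈x)))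

  mutual
    -- Truncating at `suc n` needs stability of the members of `V n`, which in turn rests on
    -- truncation at smaller levels.
    truncate : ∀ n x → Truncation n x
    truncate n x with base? x
    truncate n       x | inj₁ (ι b) = x , z≤n , base-stable n (ι b)
    truncate zero    x | inj₂ ¬b    = ∅ , z≤n , agree-by-Pow (composite (λ ()) ¬b) λ t → mk⇔
      (λ _ z z∈x → ⊥-elim (¬b (∈ᵇ⇒Baseʳ z∈x)))
      (λ { _ z (b , ¬b) → ⊥-elim (¬b b) })
    -- `V n` stands on the left because the left side alone determines the rank; that of `x` is
    -- arbitrary.
    truncate (suc n) x | inj₂ ¬b    = V n ∩ x , rank-V n , agree-by-Pow (composite (λ ()) ¬b) λ t → mk⇔
      (λ h z z∈x → let z′ , _ , z′~z = truncate n z in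
        to (z′~z t) (h z′ (from (z′~z (V n)) (∈[]-V n z) , from (z′~z x) z∈x)))
      (λ { h z (z∈V , z∈x) → from (V-stable n z z∈V t) (h z (to (V-stable n z z∈V x) z∈x)) })

    V-stable : ∀ n x → x ∈[ suc n ] V n → Stable n x
    V-stable zero    x (inj₁ b) = base-stable zero b
    V-stable zero    x (inj₂ x⊆∅) with base? x
    ... | inj₁ b  = base-stable zero b
    ... | inj₂ ¬b = agree-by-Pow same λ t → mk⇔
      (λ _ z z∈x → ⊥-elim (¬b (∈ᵇ⇒Baseʳ z∈x)))
      (λ _ z z∈x → let b , ¬b = x⊆∅ z z∈x in ⊥-elim (¬b b))
    V-stable (suc n) x x⊆V = stable-suc (truncate n) λ z z∈x → V-stable n z (x⊆V z z∈x)

  member-stable : ∀ {n} x → rank x ≤ n → ∀ z → z ∈[ suc n ] x → Stable n z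
  member-stable (ι b)   r       z z∈b        = base-stable _ (∈ᵇ⇒Baseˡ z∈b)
  member-stable 𝔹       r       z z∈𝔹        = base-stable _ z∈𝔹
  member-stable (s ∪ t) r       z (inj₁ z∈s) = member-stable s (m⊔n≤o⇒m≤o (rank s) (rank t) r) z z∈s
  member-stable (s ∪ t) r       z (inj₂ z∈t) = member-stable t (m⊔n≤o⇒n≤o (rank s) (rank t) r) z z∈t
  member-stable (s ∩ t) r       z (z∈s , _)  = member-stable s r z z∈s
  member-stable (s ∖ t) r       z (z∈s , _)  = member-stable s r z z∈s
  member-stable (Pow t) (s≤s r) z z⊆t        =
    stable-suc (truncate _) λ w w∈z → member-stable t r w (z⊆t w w∈z)

  -- Membership at the stable level and the power set axiom

  rank-stable : ∀ {n} x → rank x ≤ n → Stable (suc n) x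
  rank-stable x r = stable-suc (truncate _) (member-stable x r)

  -- The first level at which `rank-stable` applies to `x`.
  _∈_ : Term → Term → Set
  x ∈ t = x ∈[ suc (rank x) ] t

  ∈-level : ∀ {n} x → rank x ≤′ n → Agree (suc n) x (suc (rank x)) x
  ∈-level x ≤′-refl     t = ⇔-refl
  ∈-level x (≤′-step r) t = ∈-level x r t ⇔-∘ rank-stable x (≤′⇒≤ r) t

  member-level : ∀ {n} x → rank x ≤′ n → ∀ z → z ∈[ n ] x → Agree n z (rank x) z
  member-level x ≤′-refl     z z∈x t = ⇔-refl
  member-level x (≤′-step r) z z∈x t =
    member-level x r z (to (st x) z∈x) t ⇔-∘ st t
    where st = member-stable x (≤′⇒≤ r) z z∈x

  -- The left side tests every `z` at level `rank x`, the right side each `z` at its own level.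
  ∈-Pow : ∀ x y → x ∈ Pow y ⇔ (∀ z → z ∈ x → z ∈ y)
  ∈-Pow x y = mk⇔ ⇒ ⇐
    where
    ⇒ : x ∈ Pow y → ∀ z → z ∈ x → z ∈ y
    ⇒ x⊆y z z∈x = to (high y) (from (low y) (x⊆y z (to (low x) z∈ⁿx)))
      where
      -- Above both ranks, `z` is settled both as a term and as a member of `x`.
      n = rank z ⊔ rank x

      high : Agree (suc n) z (suc (rank z)) z
      high = ∈-level z (≤⇒≤′ (m≤m⊔n (rank z) (rank x)))

      z∈ⁿx : z ∈[ suc n ] x
      z∈ⁿx = from (high x) z∈x

      low : Agree (suc n) z (rank x) z
      low = member-level x (≤′-step (≤⇒≤′ (m≤n⊔m (rank z) (rank x)))) z z∈ⁿx

    ⇐ : (∀ z → z ∈ x → z ∈ y) → x ∈ Pow y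
    -- The rank of `z` may exceed that of `x`, so the hypothesis is applied to its truncation.
    ⇐ x⊆y z z∈x with z′ , r , z′~z ← truncate (rank x) z =
      to (z′~z y) (from (high y) (x⊆y z′ (to (high x) (from (z′~z x) z∈x))))
      where
      high : Agree (suc (rank x)) z′ (suc (rank z′)) z′
      high = ∈-level z′ (≤⇒≤′ r)

  model : ΩModel
  model = record
    { 𝒰         = Term
    ; _∈_       = _∈_
    ; _⊆_       = λ x y → ∀ z → z ∈ x → z ∈ y
    ; _∪_       = _∪_
    ; _∖_       = _∖_
    ; Pow       = Pow
    ; ∪-axiom   = λ _ _ _ → ⇔-refl
    ; ∖-axiom   = λ _ _ _ → ⇔-refl
    ; ⊆-axiom   = λ _ _ → ⇔-refl
    ; Pow-axiom = ∈-Pow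
    }

-- The interpretation built from a model of the translation

module Completeness {S : Signature} (K : ALCΩ.KB S) (F : ALCΩ.Query S)
  (I : ALCOI.Interpretation (Translation.Sᵀ K F))
  (I⊨Kᵀ : ALCOI.IsModel (Translation.Sᵀ K F) I (Translation.KBᵀ K F))
  where

  open Signature S
  open ALCΩ S
  open Translation K F
  open O.Interpretation I using (Domain; nonempty) renaming (⟦_⟧ to ⟦_⟧ᴼ; roleᴵ to roleᴼ; indᴵ to indᴼ)

  data BaseSet : Set where
    el  : Domain → BaseSet
    con : Concept → BaseSet

  -- If `C` does not occur as an instance, `con C` represents nothing and so belongs to no base set.
  data Represents : BaseSet → Domain → Set where
    el  : ∀ d → Represents (el d) d
    con : ∀ {C} (o : OccursAsInstance C) → Represents (con C) (indᴼ (e[ C ] o))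

  represents-unique : ∀ {b d d′} → Represents b d → Represents b d′ → d ≡ d′
  represents-unique (el d)  (el .d)  = refl
  represents-unique (con o) (con o′) = refl

  Extension : BaseSet → Domain → Set
  Extension (el d)  d′ = roleᴼ e d d′
  Extension (con C) d′ = ⟦ C ᵀ ⟧ᴼ d′

  module Sup = Superstructure (λ a b → ∃ λ d → Represents a d × Extension b d)
  open Sup using (Term; ι)

  data _≈_ : Term → Domain → Set where
    ι : ∀ {b d} → Represents b d → ι b ≈ d

  ≈-unique : ∀ {x d d′} → x ≈ d → x ≈ d′ → d ≡ d′
  ≈-unique (ι p) (ι q) = represents-unique p q

  ∈-ι : ∀ b x → x Sup.∈ ι b ⇔ (∃ λ d → x ≈ d × Extension b d)
  ∈-ι b x = mk⇔ (λ { (ι (d , p , q)) → d , ι p , q }) (λ { (d , ι p , q) → ι (d , p , q) })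

  ext⇒∈ : ∀ {b x d} → x ≈ d → Extension b d → x Sup.∈ ι b
  ext⇒∈ p q = from (∈-ι _ _) (_ , p , q)

  ∈⇒ext : ∀ {b x d} → x ≈ d → x Sup.∈ ι b → Extension b d
  ∈⇒ext {b} p h with _ , q , r ← to (∈-ι _ _) h = subst (Extension b) (≈-unique q p) r

  -- For `con C` the two directions are the two naming inclusions.
  represents-extension : ∀ {b d} → Represents b d → ∀ d′ → Extension b d′ ⇔ roleᴼ e d d′
  represents-extension (el d)  d′ = ⇔-refl
  represents-extension (con o) d′ = mk⇔
    (λ h → case-naming (proj₁ I⊨Kᵀ _ (naming-⊑ o) d′ h))
    (λ h → proj₁ I⊨Kᵀ _ (naming-⊒ o) d′ (_ , h , refl))
    where
    case-naming : ∀ {c} → (∃ λ d → roleᴼ e d d′ × d ≡ c) → roleᴼ e c d′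
    case-naming (_ , h , refl) = h

  -- Irrelevance of the emptiness proof makes atom injective.
  record Atom : Set where
    constructor atom
    field
      element : Domain
      .empty  : ∀ d → ¬ roleᴼ e element d

  open Atom

  named : Concept → Term
  named C = ι (con C)

  ∈Δ : ∀ {x d} → x ≈ d → x Sup.∈ named ⊤
  ∈Δ p = ext⇒∈ p tt

  ∈-named⇒∈Δ : ∀ {b x} → x Sup.∈ ι b → x Sup.∈ named ⊤
  ∈-named⇒∈Δ h with _ , p , _ ← to (∈-ι _ _) h = ∈Δ p

  -- Ranging over all representatives makes `con C` inherit the roles of the element named
  -- `e[ C ] o`.
  roleᵁ : RoleName → Term → Term → Set
  roleᵁ R x y = ∃ λ d → ∃ λ d′ → x ≈ d × y ≈ d′ × roleᴼ (old R) d d′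

  -- This justifies translating `Pow` by a restriction along `e`: the members of `x` represent the
  -- `e`-successors of `d`, and testing each `el d′` suffices.
  ≈-Pow : ∀ {x d} → x ≈ d → ∀ C →
          (∀ z → z Sup.∈ x → z Sup.∈ named C) ⇔ (∀ d′ → roleᴼ e d d′ → ⟦ C ᵀ ⟧ᴼ d′)
  ≈-Pow (ι p) C = mk⇔
    (λ h d′ q → ∈⇒ext {con C} (ι (el d′)) (h _ (ext⇒∈ (ι (el d′)) (from (represents-extension p d′) q))))
    (λ { h _ (ι (d′ , q , r)) → ι (d′ , q , h d′ (to (represents-extension p d′) r)) })

  interpretation : Interpretation Atom
  interpretation = record
    { modelΩ = record
      { Ω              = Sup.model
      ; atom           = λ α → ι (el (element α))
      ; atom-injective = λ { {atom _ _} {atom _ _} refl → refl }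
      ; atom-empty     = λ { (atom _ p) _ (ι (d , _ , q)) → ⊥-elim-irr (p d q) }
      }
    ; Δ            = named ⊤
    ; Δ-nonempty   = _ , ∈Δ (ι (el nonempty))
    -- Members of base sets represent some element, hence lie in `named ⊤`.
    ; Δ-transitive = λ { _ (ι _) _ → ∈-named⇒∈Δ }
    ; ⟦_⟧          = named
    ; roleᴵ        = roleᵁ
    ; indᴵ         = λ a → atom (indᴼ (old a)) (λ d h → proj₂ I⊨Kᵀ _ (atomic a) (d , h , tt))
    ; name-⊆       = λ _ _ → ∈-named⇒∈Δ
    ; role-⊆       = λ { _ _ _ (_ , _ , p , q , _) → ∈Δ p , ∈Δ q }
    ; ind-∈        = λ a → ∈Δ (ι (el _))
    ; ⟦⊤⟧          = λ _ → ⇔-refl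
    ; ⟦⊥⟧          = λ { _ (ι (_ , _ , ())) }
    ; ⟦¬⟧          = λ C _ → mk⇔
        (λ { (ι (d , p , q)) → ∈Δ (ι p) , q ∘ ∈⇒ext {con C} (ι p) })
        (λ { (ι (d , p , _) , h) → ι (d , p , h ∘ ext⇒∈ (ι p)) })
    ; ⟦⊓⟧          = λ C D _ → mk⇔
        (λ { (ι (d , p , q , r)) → ι (d , p , q) , ι (d , p , r) })
        (λ { (ι (d , p , q) , h) → ι (d , p , q , ∈⇒ext {con D} (ι p) h) })
    ; ⟦⊔⟧          = λ C D _ → mk⇔
        (λ { (ι (d , p , inj₁ q)) → inj₁ (ι (d , p , q)) ; (ι (d , p , inj₂ q)) → inj₂ (ι (d , p , q)) })
        (λ { (inj₁ (ι (d , p , q))) → ι (d , p , inj₁ q) ; (inj₂ (ι (d , p , q))) → ι (d , p , inj₂ q) })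
    ; ⟦∖⟧          = λ C D _ → mk⇔
        (λ { (ι (d , p , q , r)) → ι (d , p , q) , r ∘ ∈⇒ext {con D} (ι p) })
        (λ { (ι (d , p , q) , h) → ι (d , p , q , h ∘ ext⇒∈ (ι p)) })
    ; ⟦Pow⟧        = λ C x → mk⇔
        (λ { (ι (d , p , q)) → from (Sup.∈-Pow x (named C)) (from (≈-Pow (ι p) C) q) , ∈Δ (ι p) })
        (λ { (h , ι (d , p , _)) → ι (d , p , to (≈-Pow (ι p) C) (to (Sup.∈-Pow x (named C)) h)) })
    ; ⟦∀⟧          = λ R C _ → mk⇔
        (λ { (ι (d , p , q)) → ∈Δ (ι p) , λ { y (d₁ , d′ , p₁ , p′ , r) →
               ext⇒∈ p′ (q d′ (subst (λ c → roleᴼ (old R) c d′) (≈-unique p₁ (ι p)) r)) } })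
        (λ { (ι (d , p , _) , h) → ι (d , p , λ d′ r →
               ∈⇒ext {con C} (ι (el d′)) (h _ (d , d′ , ι p , ι (el d′) , r))) })
    ; ⟦∃⟧          = λ R C _ → mk⇔
        (λ { (ι (d , p , d′ , r , q)) →
               ∈Δ (ι p) , _ , (d , d′ , ι p , ι (el d′) , r) , ext⇒∈ (ι (el d′)) q })
        (λ { (_ , y , (d , d′ , ι p , p′ , r) , h) → ι (d , p , d′ , r , ∈⇒ext {con C} p′ h) })
    }

  -- Satisfaction of the knowledge base and transfer of the query

  assertion-holds : ∀ α → α ∈ˡ KB.ABox K → SatisfiesAssertion interpretation α
  assertion-holds (instanceOf C a) p = ext⇒∈ (ι (el _)) (proj₂ I⊨Kᵀ _ (concept p))
  assertion-holds (related R a b)  p = _ , _ , ι (el _) , ι (el _) , proj₂ I⊨Kᵀ _ (role p)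
  assertion-holds (C ∈ D)          p = ext⇒∈ (ι (con (in-∈ p))) (proj₂ I⊨Kᵀ _ (membership p))
  assertion-holds (relatedᶜ R C D) p =
    _ , _ , ι (con (in-role₁ p)) , ι (con (in-role₂ p)) , proj₂ I⊨Kᵀ _ (roleᶜ p)

  inclusion-holds : ∀ φ → φ ∈ˡ KB.TBox K → SatisfiesInclusion interpretation φ
  inclusion-holds (C ⊑ D) p _ (ι (d , q , r)) = ι (d , q , proj₁ I⊨Kᵀ _ (inclusion p) d r)

  interpretation-models : IsModel interpretation K
  interpretation-models =
    tabulate (λ {φ} → inclusion-holds φ) , tabulate (λ {α} → assertion-holds α)

  -- Abstracting `F` to `G` lets the case split compute the translation; `p` supplies the occurrence
  -- by which `con C` represents its named element.
  query-reflected : ∀ G (p : F ≡ G) → SatisfiesQuery interpretation G →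
                    O.SatisfiesQuery I (translateQuery G p)
  query-reflected (C ⊑ D)          _ h d q = ∈⇒ext {con D} (ι (el d)) (h _ (ext⇒∈ (ι (el d)) q))
  query-reflected (instanceOf C a) _ h     = ∈⇒ext {con C} (ι (el _)) h
  query-reflected (C ∈ D)          p h     = ∈⇒ext {con D} (ι (con (in-query p))) h

proposition3 : (S : Signature) (K : ALCΩ.KB S) (F : ALCΩ.Query S) →
    ALCΩ.OverLanguageOf S K F →
    ALCΩ._⊨_ S K F →
    ALCOI._⊨_ (Translation.Sᵀ K F) (Translation.KBᵀ K F) (Translation.Queryᵀ K F)
proposition3 S K F _ K⊨F I I⊨Kᵀ = query-reflected F refl (K⊨F interpretation interpretation-models)
  where open Completeness K F I I⊨Kᵀ
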